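{- Let $P$ be a team property and let $k\in\mathbb N$. Then the following are equivalent: 1. $P$ is invariant under $k$-bisimulation. 2. There is an $\mathsf{EMINCL}(\vee_{\mathrm{cl}})$-formula $\varphi$ with $\mathrm{md}(\varphi)=k$ that characterizes (i.e. expresses) $P$.
   Context: Here $\vee_{\mathrm{cl}}$ denotes classical disjunction (printed in the paper as a circled $\vee$). Fix a finite nonempty set $X$ of propositional variables. A Kripke model is $M=(W,R,\pi)$ with $W$ a nonempty set, $R\subseteq W\times W$, $\pi\colon X\to 2^W$. A team of $M$ is a set $T\subseteq W$. $\mathsf{ML}$ has syntax $\varphi ::= p\mid\neg p\mid(\varphi\wedge\varphi)\mid(\varphi\vee\varphi)\mid\Diamond\varphi\mid\Box\varphi$, $p\in X$. Team semantics, for $T\subseteq W$ (possibly empty): - $M,T\models p$ iff $T\subseteq\pi(p)$; $M,T\models\neg p$ iff $T\cap\pi(p)=\emptyset$; - $M,T\models\psi\wedge\chi$ iff $M,T\models\psi$ and $M,T\models\chi$; - $M,T\models\psi\vee\chi$ iff $T=T_1\cup T_2$ for some $T_1,T_2$ with $M,T_1\models\psi$ and $M,T_2\models\chi$; - $M,T\models\Diamond\psi$ iff there is a team $T'$ of $M$ with $M,T'\models\psi$ such that each $w\in T$ has some $w'\in T'$ with $(w,w')\in R$ and each $w'\in T'$ has some $w\in T$ with $(w,w')\in R$; - $M,T\models\Box\psi$ iff $M,T'\models\psi$ where $T'=\{w'\in W : (w,w')\in R\text{ for some }w\in T\}$. $\mathsf{EMINCL}(\vee_{\mathrm{cl}})$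 extends the formation rules of $\mathsf{ML}$ (with $p,\neg p,\wedge,\vee,\Diamond,\Box$ interpreted by the team semantics of $\mathsf{ML}$, where $\psi,\chi$ range over all formulas of $\mathsf{EMINCL}(\vee_{\mathrm{cl}})$) by: - inclusion atoms $(\varphi_1,\dots,\varphi_n)\subseteq(\psi_1,\dots,\psi_n)$ for $\mathsf{ML}$-formulas $\varphi_i,\psi_i$, with $M,T\models(\varphi_1,\dots,\varphi_n)\subseteq(\psi_1,\dots,\psi_n)$ iff for every $w\in T$ there is $w'\in T$ such that $\varphi_i(w)=\psi_i(w')$ for each $i$, where $\varphi(w)=1$ if $M,\{w\}\models\varphi$ and $\varphi(w)=0$ otherwise; - classical disjunction $\varphi\vee_{\mathrm{cl}}\psi$, with $M,T\models\varphi\vee_{\mathrm{cl}}\psi$ iff $M,T\models\varphi$ or $M,T\models\psi$. The modal depth $\mathrm{md}(\varphi)$ is the maximal nesting degree of the modal operators $\Box,\Diamond$ in $\varphi$ (including those inside the arguments of atoms). A team property is a class of pairs $(M,T)$ where $M$ is a Kripke model and $T\neq\emptyset$ is a team of $M$. A formula $\varphi$ characterizes (expresses) the class of all $(M,T)$, $T\neq\emptyset$, with $M,T\models\varphi$. $k$-bisimilarity of pointed models: $(M_1,w_1)\rightleftharpoons_0(M_2,w_2)$ iff $w_1$ and $w_2$ satisfy the same propositional variables; $(M_1,w_1)\rightleftharpoons_{k+1}(M_2,w_2)$ iff $(M_1,w_1)\rightleftharpoons_0(M_2,w_2)$, for each successor $w_1'$ of $w_1$ there is a successor $w_2'$ of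 $w_2$ with $(M_1,w_1')\rightleftharpoons_k(M_2,w_2')$, and for each successor $w_2'$ of $w_2$ there is a successor $w_1'$ of $w_1$ with $(M_1,w_1')\rightleftharpoons_k(M_2,w_2')$. For teams, $(M_1,T_1)\rightleftharpoons_k(M_2,T_2)$ iff for each $w_1\in T_1$ there is $w_2\in T_2$ with $(M_1,w_1)\rightleftharpoons_k(M_2,w_2)$, and for each $w_2\in T_2$ there is $w_1\in T_1$ with $(M_1,w_1)\rightleftharpoons_k(M_2,w_2)$. $P$ is invariant under $k$-bisimulation if $(M_1,T_1)\in P$ and $(M_1,T_1)\rightleftharpoons_k(M_2,T_2)$ imply $(M_2,T_2)\in P$. -}

module Defs where

open import Data.Nat.Base using (ℕ; zero; suc; _⊔_)
open import Data.Product.Base using (∃; _×_)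
open import Data.Sum.Base using (_⊎_)
open import Data.Vec.Functional using (Vector; foldr)
open import Function.Bundles using (_⇔_)
open import Level using (Level; Lift) renaming (suc to lsuc; _⊔_ to _⊔ˡ_)
open import Relation.Unary
  using (Pred; _∈_; _⊆_; _≐_; _∪_; _∩_; ｛_｝; Empty; Satisfiable)

-- Subsets are predicates, and they are only ever compared extensionally (_≐_).
record Model (X : Set) (ℓ : Level) : Set (lsuc ℓ) where
  field
    W        : Set ℓ
    nonempty : W
    R        : W → W → Set ℓ
    π        : X → Pred W ℓ

open Model

Team : ∀ {X ℓ} → Model X ℓ → Set (lsuc ℓ)
Team {ℓ = ℓ} M = Pred (W M) ℓ

image : ∀ {X ℓ} (M : Model X ℓ) → Team M → Team M
image M T w′ = ∃ λ w → w ∈ T × R M w w′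

data Logic : Set where
  ML          : Logic
  EMINCL[∨cl] : Logic

infixr 7 _∧_
infixr 6 _∨_ _∨cl_

data Formula (X : Set) : Logic → Set where
  var neg : ∀ {L} → X → Formula X L
  _∧_ _∨_ : ∀ {L} → Formula X L → Formula X L → Formula X L
  ◇_ □_   : ∀ {L} → Formula X L → Formula X L
  -- incl φs ψs is the atom (φ₁,…,φₘ) ⊆ (ψ₁,…,ψₘ) with m = suc n ≥ 1.
  incl    : ∀ {n} (φs ψs : Vector (Formula X ML) (suc n)) →
            Formula X EMINCL[∨cl]
  _∨cl_   : (φ ψ : Formula X EMINCL[∨cl]) → Formula X EMINCL[∨cl]

md : ∀ {X L} → Formula X L → ℕ
md (var p)      = 0
md (neg p)      = 0
md (φ ∧ ψ)      = md φ ⊔ md ψ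
md (φ ∨ ψ)      = md φ ⊔ md ψ
md (◇ φ)        = suc (md φ)
md (□ φ)        = suc (md φ)
md (incl φs ψs) = foldr _⊔_ 0 (λ i → md (φs i)) ⊔ foldr _⊔_ 0 (λ i → md (ψs i))
md (φ ∨cl ψ)    = md φ ⊔ md ψ

infix 4 _,_⊨_

-- The clauses for ∨ and ◇ quantify over teams, hence the level lsuc ℓ.
-- In the inclusion atom, equality of the truth values φᵢ(w) and ψᵢ(w′) in {0,1}
-- is equivalence of the propositions of which they are the characteristic values.
_,_⊨_ : ∀ {X ℓ L} (M : Model X ℓ) → Team M → Formula X L → Set (lsuc ℓ)
_,_⊨_ {ℓ = ℓ} M T (var p) = Lift (lsuc ℓ) (T ⊆ π M p)
_,_⊨_ {ℓ = ℓ} M T (neg p) = Lift (lsuc ℓ) (Empty (T ∩ π M p))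
M , T ⊨ φ ∧ ψ = (M , T ⊨ φ) × (M , T ⊨ ψ)
M , T ⊨ φ ∨ ψ =
  ∃ λ (T₁ : Team M) → ∃ λ (T₂ : Team M) →
    T ≐ (T₁ ∪ T₂) × (M , T₁ ⊨ φ) × (M , T₂ ⊨ ψ)
M , T ⊨ ◇ φ =
  ∃ λ (T′ : Team M) →
    (M , T′ ⊨ φ) ×
    (∀ w → w ∈ T → ∃ λ w′ → w′ ∈ T′ × R M w w′) ×
    (∀ w′ → w′ ∈ T′ → ∃ λ w → w ∈ T × R M w w′)
M , T ⊨ □ φ = M , image M T ⊨ φ
M , T ⊨ incl φs ψs =
  ∀ w → w ∈ T → ∃ λ w′ → w′ ∈ T ×
    (∀ i → (M , ｛ w ｝ ⊨ φs i) ⇔ (M , ｛ w′ ｝ ⊨ ψs i))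
M , T ⊨ φ ∨cl ψ = (M , T ⊨ φ) ⊎ (M , T ⊨ ψ)

-- holds is not assumed to respect _≐_ on teams: invariance under bisimulation and
-- characterization by a formula each imply it.
record TeamProperty (X : Set) (ℓ p : Level) : Set (lsuc (ℓ ⊔ˡ p)) where
  field
    holds          : (M : Model X ℓ) → Team M → Set p
    holds⇒nonempty : ∀ M T → holds M T → Satisfiable T

open TeamProperty

_Characterizes_ : ∀ {X ℓ p L} → Formula X L → TeamProperty X ℓ p →
                  Set (lsuc ℓ ⊔ˡ p)
φ Characterizes P = ∀ M T → holds P M T ⇔ (Satisfiable T × (M , T ⊨ φ))

PointBisim : ∀ {X ℓ} → ℕ → (M₁ : Model X ℓ) → W M₁ → (M₂ : Model X ℓ) → W M₂ → Set ℓ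
PointBisim zero M₁ w₁ M₂ w₂ = ∀ p → w₁ ∈ π M₁ p ⇔ w₂ ∈ π M₂ p
PointBisim (suc k) M₁ w₁ M₂ w₂ =
  PointBisim zero M₁ w₁ M₂ w₂ ×
  (∀ w₁′ → R M₁ w₁ w₁′ → ∃ λ w₂′ → R M₂ w₂ w₂′ × PointBisim k M₁ w₁′ M₂ w₂′) ×
  (∀ w₂′ → R M₂ w₂ w₂′ → ∃ λ w₁′ → R M₁ w₁ w₁′ × PointBisim k M₁ w₁′ M₂ w₂′)

TeamBisim : ∀ {X ℓ} → ℕ → (M₁ : Model X ℓ) → Team M₁ → (M₂ : Model X ℓ) → Team M₂ → Set ℓ
TeamBisim k M₁ T₁ M₂ T₂ =
  (∀ w₁ → w₁ ∈ T₁ → ∃ λ w₂ → w₂ ∈ T₂ × PointBisim k M₁ w₁ M₂ w₂) ×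
  (∀ w₂ → w₂ ∈ T₂ → ∃ λ w₁ → w₁ ∈ T₁ × PointBisim k M₁ w₁ M₂ w₂)

BisimInvariant : ∀ {X ℓ p} → ℕ → TeamProperty X ℓ p → Set (lsuc ℓ ⊔ˡ p)
BisimInvariant k P = ∀ M₁ T₁ M₂ T₂ →
  holds P M₁ T₁ → TeamBisim k M₁ T₁ M₂ T₂ → holds P M₂ T₂

{-# OPTIONS --safe #-}
-- Inclusion atoms compare truth values at single worlds, so (θ) ⊆ (⊤) says that θ holds
-- throughout a team, and (⊤) ⊆ (θ) says that θ holds somewhere in a nonempty team.  Up to
-- k-bisimilarity there are finitely many pointed models, described by Hintikka formulas,
-- and a team is determined up to k-bisimilarity by the set S of Hintikka formulas that it
-- realises.  That set is fixed by (⋁ S) ⊆ (⊤) together with (⊤) ⊆ (χ) for χ ∈ S, and an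
-- invariant property is the classical disjunction of these over the sets S that some team
-- with the property realises.  Taking □ᵏ ⊤ for ⊤ makes the modal depth exactly k.
module Submission where

open import Defs
open import Axiom.ExcludedMiddle using (ExcludedMiddle)
open import Data.Empty using (⊥-elim)
open import Data.Fin.Base using (Fin; zero; suc)
open import Data.List.Base
  using (List; []; _∷_; _++_; map; foldr; filter; allFin; cartesianProductWith)
open import Data.List.Membership.Propositional using (find; lose) renaming (_∈_ to _∈ᴸ_)
open import Data.List.Membership.Propositional.Properties
  using (∈-map⁺; ∈-map⁻; ∈-++⁺ˡ; ∈-++⁺ʳ; ∈-++⁻; ∈-allFin; ∈-filter⁺; ∈-filter⁻;
         ∈-cartesianProductWith⁺; ∈-cartesianProductWith⁻)
open import Data.List.Relation.Binary.Permutation.Propositional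
  using (_↭_; ↭-refl; ↭-sym; ↭-trans; prep)
open import Data.List.Relation.Binary.Permutation.Propositional.Properties
  using (shift; ∈-resp-↭)
open import Data.List.Relation.Unary.All as All using (All; []; _∷_)
open import Data.List.Relation.Unary.Any using (Any; here; there)
open import Data.Nat.Base using (ℕ; zero; suc; _≤_; _⊔_; z≤n; s≤s)
open import Data.Nat.Properties
  using (≤-refl; ≤-reflexive; ≤-trans; m≤m⊔n; m≤n⊔m; m⊔n≤o⇒m≤o; m⊔n≤o⇒n≤o; ⊔-lub;
         ⊔-identityʳ; m≥n⇒m⊔n≡m; m≤n⇒m⊔n≡n)
open import Data.Product.Base using (∃; _×_; _,_; proj₁; proj₂; map₁; map₂)
open import Data.Sum.Base as Sum using (_⊎_; inj₁; inj₂; [_,_]′)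
open import Data.Vec.Functional as Vector using (Vector)
open import Function.Base using (_∘_)
open import Function.Bundles using (_⇔_; _↔_; mk⇔; Equivalence; Inverse)
open import Function.Properties.Equivalence using ()
  renaming (sym to ⇔-sym; trans to ⇔-trans)
open import Level using (Level; lift)
open import Relation.Binary.PropositionalEquality
  using (_≡_; refl; trans; cong; cong₂; subst)
open import Relation.Nullary using (¬_; Dec; yes; no)
open import Relation.Unary using (Pred; _∈_; ｛_｝; Satisfiable)

open Model
open TeamProperty
open Equivalence using (to; from)

private
  variable
    ℓ : Level
    A X : Set
    L : Logic

-- Bisimulation, and the invariance of formulas under it.

PointBisim⇒0 : ∀ k {M₁ M₂ : Model X ℓ} {w₁ w₂} →
               PointBisim k M₁ w₁ M₂ w₂ → PointBisim 0 M₁ w₁ M₂ w₂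
PointBisim⇒0 zero    b = b
PointBisim⇒0 (suc k) b = proj₁ b

PointBisim-sym : ∀ k {M₁ M₂ : Model X ℓ} {w₁ w₂} →
                 PointBisim k M₁ w₁ M₂ w₂ → PointBisim k M₂ w₂ M₁ w₁
PointBisim-sym zero b p = ⇔-sym (b p)
PointBisim-sym (suc k) (b , forth , back) =
  (λ p → ⇔-sym (b p)) ,
  (λ v r → let u , r′ , b′ = back v r in u , r′ , PointBisim-sym k b′) ,
  (λ v r → let u , r′ , b′ = forth v r in u , r′ , PointBisim-sym k b′)

TeamBisim-singleton : ∀ k {M₁ M₂ : Model X ℓ} {w₁ w₂} →
                      PointBisim k M₁ w₁ M₂ w₂ → TeamBisim k M₁ ｛ w₁ ｝ M₂ ｛ w₂ ｝
TeamBisim-singleton k b =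
  (λ { _ refl → _ , refl , b }) , (λ { _ refl → _ , refl , b })

TeamBisim-image : ∀ k {M₁ M₂ : Model X ℓ} {T₁ T₂} → TeamBisim (suc k) M₁ T₁ M₂ T₂ →
                  TeamBisim k M₁ (image M₁ T₁) M₂ (image M₂ T₂)
TeamBisim-image k (forth , back) =
  (λ { v (w , w∈ , r) →
         let w₂ , w₂∈ , _ , f , _ = forth w w∈ ; v₂ , r₂ , b = f v r
         in v₂ , (w₂ , w₂∈ , r₂) , b }) ,
  (λ { v (w , w∈ , r) →
         let w₁ , w₁∈ , _ , _ , g = back w w∈ ; v₁ , r₁ , b = g v r
         in v₁ , (w₁ , w₁∈ , r₁) , b })

lookup≤foldr-⊔ : ∀ {n} (f : Vector ℕ n) i → f i ≤ Vector.foldr _⊔_ 0 f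
lookup≤foldr-⊔ f zero    = m≤m⊔n _ _
lookup≤foldr-⊔ f (suc i) = ≤-trans (lookup≤foldr-⊔ (f ∘ suc) i) (m≤n⊔m (f zero) _)

-- Induction on the formula. Bounding the depth by `k` lets both sides of a connective keep the same
-- `k`; it drops by one only under a modality, where one level of bisimilarity is spent on moving to
-- successors.
⊨-invariant : ∀ (φ : Formula X L) {k} → md φ ≤ k → {M₁ M₂ : Model X ℓ} {T₁ : Team M₁}
              {T₂ : Team M₂} → TeamBisim k M₁ T₁ M₂ T₂ → M₁ , T₁ ⊨ φ → M₂ , T₂ ⊨ φ
⊨-invariant (var p) {k} _ (_ , back) (lift h) = lift λ w₂∈ →
  let w₁ , w₁∈ , b = back _ w₂∈ in to (PointBisim⇒0 k b p) (h w₁∈)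
⊨-invariant (neg p) {k} _ (_ , back) (lift h) = lift λ { w₂ (w₂∈ , v) →
  let w₁ , w₁∈ , b = back w₂ w₂∈ in h w₁ (w₁∈ , from (PointBisim⇒0 k b p) v) }
⊨-invariant (φ ∧ ψ) d b (hφ , hψ) =
  ⊨-invariant φ (m⊔n≤o⇒m≤o _ _ d) b hφ , ⊨-invariant ψ (m⊔n≤o⇒n≤o (md φ) _ d) b hψ
⊨-invariant (φ ∨ ψ) {k} d {M₁} {M₂} {T₁} {T₂} (forth , back) (U , V , (T⊆ , ⊆T) , hφ , hψ) =
  transfer U , transfer V ,
  ((λ w₂∈ → let w₁ , w₁∈ , b = back _ w₂∈
            in Sum.map (λ u → w₂∈ , w₁ , u , b) (λ v → w₂∈ , w₁ , v , b) (T⊆ w₁∈)) ,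
   [ proj₁ , proj₁ ]′) ,
  ⊨-invariant φ (m⊔n≤o⇒m≤o _ _ d) (transfer-bisim U (⊆T ∘ inj₁)) hφ ,
  ⊨-invariant ψ (m⊔n≤o⇒n≤o (md φ) _ d) (transfer-bisim V (⊆T ∘ inj₂)) hψ
  where
  -- The split of `T₁` is copied to `T₂` by taking all partners of each half. The back condition
  -- makes the two copies cover `T₂`; the forth condition makes each copy bisimilar to its original.
  transfer : Team M₁ → Team M₂
  transfer U w₂ = w₂ ∈ T₂ × ∃ λ w₁ → w₁ ∈ U × PointBisim k M₁ w₁ M₂ w₂
  transfer-bisim : ∀ U → (∀ {w} → w ∈ U → w ∈ T₁) → TeamBisim k M₁ U M₂ (transfer U)
  transfer-bisim U U⊆T =
    (λ w₁ u → let w₂ , w₂∈ , b = forth w₁ (U⊆T u) in w₂ , (w₂∈ , w₁ , u , b) , b) ,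
    (λ w₂ → proj₂)
⊨-invariant (◇ φ) {suc k} (s≤s d) {M₁} {M₂} {T₁} {T₂} (forth , back) (U , hφ , T→U , U→T) =
  U′ ,
  ⊨-invariant φ d
    ((λ v u → let w , w∈ , r = U→T v u ; w₂ , w₂∈ , _ , f , _ = forth w w∈ ; v₂ , r₂ , b = f v r
              in v₂ , ((w₂ , w₂∈ , r₂) , v , u , b) , b) ,
     (λ v → proj₂)) hφ ,
  (λ w₂ w₂∈ →
     let w , w∈ , _ , f , _ = back w₂ w₂∈ ; v , u , r = T→U w w∈ ; v₂ , r₂ , b = f v r
     in v₂ , ((w₂ , w₂∈ , r₂) , v , u , b) , r₂) ,
  (λ v → proj₁)
  where
  -- Cutting the partners of `U` down to the image of `T₂` gives every world of `U′` a predecessor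
  -- in `T₂`.
  U′ : Team M₂
  U′ v₂ = v₂ ∈ image M₂ T₂ × ∃ λ v → v ∈ U × PointBisim k M₁ v M₂ v₂
⊨-invariant (□ φ) {suc k} (s≤s d) b h = ⊨-invariant φ d (TeamBisim-image k b) h
⊨-invariant (incl φs ψs) {k} d {M₁} {M₂} (forth , back) h w₂ w₂∈ =
  -- Go back to `T₁`, apply the atom there, and return to `T₂`. Both passages preserve the truth
  -- values of the arguments, since singletons of bisimilar worlds are bisimilar teams.
  let w , w∈ , b = back w₂ w₂∈ ; v , v∈ , e = h w w∈ ; v₂ , v₂∈ , c = forth v v∈
  in v₂ , v₂∈ , λ i →
     ⇔-trans (⊨-singleton (φs i) (≤-trans (lookup≤foldr-⊔ (md ∘ φs) i) (m⊔n≤o⇒m≤o _ _ d))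
                (PointBisim-sym k b))
       (⇔-trans (e i)
         (⊨-singleton (ψs i) (≤-trans (lookup≤foldr-⊔ (md ∘ ψs) i)
           (m⊔n≤o⇒n≤o (Vector.foldr _⊔_ 0 (md ∘ φs)) _ d)) c))
  where
  ⊨-singleton : ∀ φ → md φ ≤ k → ∀ {N₁ N₂ w v} → PointBisim k N₁ w N₂ v →
                (N₁ , ｛ w ｝ ⊨ φ) ⇔ (N₂ , ｛ v ｝ ⊨ φ)
  ⊨-singleton φ d b =
    mk⇔ (⊨-invariant φ d (TeamBisim-singleton k b))
        (⊨-invariant φ d (TeamBisim-singleton k (PointBisim-sym k b)))
⊨-invariant (φ ∨cl ψ) d b =
  Sum.map (⊨-invariant φ (m⊔n≤o⇒m≤o _ _ d) b) (⊨-invariant ψ (m⊔n≤o⇒n≤o (md φ) _ d) b)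

characterizes⇒invariant : ∀ {p k} {P : TeamProperty X ℓ p} (φ : Formula X L) → md φ ≤ k →
                          φ Characterizes P → BisimInvariant k P
characterizes⇒invariant φ d char M₁ T₁ M₂ T₂ h b =
  let (w , w∈) , t = to (char M₁ T₁) h ; v , v∈ , _ = proj₁ b w w∈
  in from (char M₂ T₂) ((v , v∈) , ⊨-invariant φ d b t)

-- Flatness: team semantics of `ML` reduces to single worlds.

infix 4 _,_⊩_

-- Ordinary Kripke semantics. It quantifies over worlds instead of teams and therefore lives one
-- universe lower than `_,_⊨_`.
_,_⊩_ : (M : Model X ℓ) → W M → Formula X ML → Set ℓ
M , w ⊩ var p = w ∈ π M p
M , w ⊩ neg p = ¬ w ∈ π M p
M , w ⊩ φ ∧ ψ = (M , w ⊩ φ) × (M , w ⊩ ψ)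
M , w ⊩ φ ∨ ψ = (M , w ⊩ φ) ⊎ (M , w ⊩ ψ)
M , w ⊩ ◇ φ   = ∃ λ v → R M w v × (M , v ⊩ φ)
M , w ⊩ □ φ   = ∀ v → R M w v → M , v ⊩ φ

flat⇒ : (M : Model X ℓ) (φ : Formula X ML) {T : Team M} →
        M , T ⊨ φ → ∀ w → w ∈ T → M , w ⊩ φ
flat⇒ M (var p) (lift h) w w∈ = h w∈
flat⇒ M (neg p) (lift h) w w∈ v = h w (w∈ , v)
flat⇒ M (φ ∧ ψ) (hφ , hψ) w w∈ = flat⇒ M φ hφ w w∈ , flat⇒ M ψ hψ w w∈
flat⇒ M (φ ∨ ψ) (U , V , (T⊆ , _) , hφ , hψ) w w∈ =
  Sum.map (flat⇒ M φ hφ w) (flat⇒ M ψ hψ w) (T⊆ w∈)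
flat⇒ M (◇ φ) (U , hφ , T→U , _) w w∈ =
  let v , u , r = T→U w w∈ in v , r , flat⇒ M φ hφ v u
flat⇒ M (□ φ) h w w∈ v r = flat⇒ M φ h v (w , w∈ , r)

flat⇐ : (M : Model X ℓ) (φ : Formula X ML) {T : Team M} →
        (∀ w → w ∈ T → M , w ⊩ φ) → M , T ⊨ φ
flat⇐ M (var p) h = lift λ w∈ → h _ w∈
flat⇐ M (neg p) h = lift λ { w (w∈ , v) → h w w∈ v }
flat⇐ M (φ ∧ ψ) h =
  flat⇐ M φ (λ w w∈ → proj₁ (h w w∈)) , flat⇐ M ψ (λ w w∈ → proj₂ (h w w∈))
flat⇐ M (φ ∨ ψ) {T} h =
  -- The largest admissible subteams serve as witnesses, so no choice between the disjuncts is made;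
  -- likewise for `◇` below, with all suitable successors.
  (λ w → w ∈ T × (M , w ⊩ φ)) , (λ w → w ∈ T × (M , w ⊩ ψ)) ,
  ((λ w∈ → Sum.map (w∈ ,_) (w∈ ,_) (h _ w∈)) , [ proj₁ , proj₁ ]′) ,
  flat⇐ M φ (λ w → proj₂) , flat⇐ M ψ (λ w → proj₂)
flat⇐ M (◇ φ) {T} h =
  (λ v → v ∈ image M T × (M , v ⊩ φ)) ,
  flat⇐ M φ (λ v → proj₂) ,
  (λ w w∈ → let v , r , hv = h w w∈ in v , ((w , w∈ , r) , hv) , r) ,
  (λ v → proj₁)
flat⇐ M (□ φ) h = flat⇐ M φ λ { v (w , w∈ , r) → h w w∈ v r }

⊨-singleton⇔⊩ : (M : Model X ℓ) (φ : Formula X ML) {w : W M} →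
                (M , ｛ w ｝ ⊨ φ) ⇔ (M , w ⊩ φ)
⊨-singleton⇔⊩ M φ = mk⇔ (λ h → flat⇒ M φ h _ refl) (λ h → flat⇐ M φ λ { _ refl → h })

-- Sublists of a finite list together with their complements.

-- The complement is kept because both halves matter: as positive and negative literals in a
-- diagram, and as realised and unrealised types of a team.
splits : List A → List (List A × List A)
splits []       = ([] , []) ∷ []
splits (x ∷ xs) = map (map₁ (x ∷_)) (splits xs) ++ map (map₂ (x ∷_)) (splits xs)

splits-↭ : ∀ (xs : List A) {ys zs} → (ys , zs) ∈ᴸ splits xs → ys ++ zs ↭ xs
splits-↭ []       (here refl) = ↭-refl
splits-↭ (x ∷ xs) s∈ with ∈-++⁻ (map (map₁ (x ∷_)) (splits xs)) s∈
... | inj₁ s∈₁ with _ , t∈ , refl ← ∈-map⁻ (map₁ (x ∷_)) s∈₁ = prep x (splits-↭ xs t∈)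
... | inj₂ s∈₂ with (ys , zs) , t∈ , refl ← ∈-map⁻ (map₂ (x ∷_)) s∈₂ =
  ↭-trans (shift x ys zs) (prep x (splits-↭ xs t∈))

subsets : List A → List (List A)
subsets xs = map proj₁ (splits xs)

∈-subsets⇒⊆ : ∀ {xs ys : List A} → ys ∈ᴸ subsets xs → ∀ {x} → x ∈ᴸ ys → x ∈ᴸ xs
∈-subsets⇒⊆ {xs = xs} ys∈ x∈ with _ , s∈ , refl ← ∈-map⁻ proj₁ ys∈ =
  ∈-resp-↭ (splits-↭ xs s∈) (∈-++⁺ˡ x∈)

-- Hintikka formulas and the classification of worlds and teams.

module Hintikka (lem : ∀ {a} → ExcludedMiddle a)
                (X : Set) (p₀ : X) (xs : List X) (∈-xs : ∀ p → p ∈ᴸ xs) where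

  decide : ∀ {a} (P : Set a) → Dec P
  decide P = lem

  splits-complete : ∀ {q} (P : Pred A q) (as : List A) →
                    ∃ λ s → s ∈ᴸ splits as × All P (proj₁ s) × All (¬_ ∘ P) (proj₂ s)
  splits-complete P [] = ([] , []) , here refl , [] , []
  splits-complete P (a ∷ as) with splits-complete P as | decide (P a)
  ... | s , s∈ , yes-ys , no-zs | yes Pa =
    map₁ (a ∷_) s , ∈-++⁺ˡ (∈-map⁺ (map₁ (a ∷_)) s∈) , Pa ∷ yes-ys , no-zs
  ... | s , s∈ , yes-ys , no-zs | no ¬Pa =
    map₂ (a ∷_) s , ∈-++⁺ʳ (map (map₁ (a ∷_)) (splits as)) (∈-map⁺ (map₂ (a ∷_)) s∈) ,
    yes-ys , ¬Pa ∷ no-zs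

  -- `ML` has no constants, so a variable supplied by the nonempty `X` stands in for them.
  ⊤′ ⊥′ : Formula X ML
  ⊤′ = var p₀ ∨ neg p₀
  ⊥′ = var p₀ ∧ neg p₀

  ⋀ ⋁ : List (Formula X ML) → Formula X ML
  ⋀ = foldr _∧_ ⊤′
  ⋁ = foldr _∨_ ⊥′

  ⊩-⊤′ : (M : Model X ℓ) {w : W M} → M , w ⊩ ⊤′
  ⊩-⊤′ M {w} with decide (w ∈ π M p₀)
  ... | yes h = inj₁ h
  ... | no  h = inj₂ h

  ⋀-intro : (M : Model X ℓ) (f : A → Formula X ML) {w : W M} {as : List A} →
            All (λ a → M , w ⊩ f a) as → M , w ⊩ ⋀ (map f as)
  ⋀-intro M f []       = ⊩-⊤′ M
  ⋀-intro M f (h ∷ hs) = h , ⋀-intro M f hs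

  ⋀-elim : (M : Model X ℓ) (f : A → Formula X ML) {w : W M} (as : List A) →
           M , w ⊩ ⋀ (map f as) → All (λ a → M , w ⊩ f a) as
  ⋀-elim M f []       _        = []
  ⋀-elim M f (_ ∷ as) (h , hs) = h ∷ ⋀-elim M f as hs

  ⋁-intro : (M : Model X ℓ) {w : W M} {φs : List (Formula X ML)} →
            Any (M , w ⊩_) φs → M , w ⊩ ⋁ φs
  ⋁-intro M (here h)  = inj₁ h
  ⋁-intro M (there h) = inj₂ (⋁-intro M h)

  ⋁-elim : (M : Model X ℓ) {w : W M} (φs : List (Formula X ML)) →
           M , w ⊩ ⋁ φs → Any (M , w ⊩_) φs
  ⋁-elim M []       (h , ¬h) = ⊥-elim (¬h h)
  ⋁-elim M (φ ∷ φs) (inj₁ h) = here h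
  ⋁-elim M (φ ∷ φs) (inj₂ h) = there (⋁-elim M φs h)

  md-⋀ : ∀ (f : A → Formula X ML) (as : List A) {k} →
         (∀ {a} → a ∈ᴸ as → md (f a) ≤ k) → md (⋀ (map f as)) ≤ k
  md-⋀ f []       d = z≤n
  md-⋀ f (a ∷ as) d = ⊔-lub (d (here refl)) (md-⋀ f as (d ∘ there))

  md-⋁ : ∀ φs {k} → (∀ {φ} → φ ∈ᴸ φs → md φ ≤ k) → md (⋁ φs) ≤ k
  md-⋁ []       d = z≤n
  md-⋁ (φ ∷ φs) d = ⊔-lub (d (here refl)) (md-⋁ φs (d ∘ there))

  diagram : List X × List X → Formula X ML
  diagram (ps , qs) = ⋀ (map var ps) ∧ ⋀ (map neg qs)

  -- The cover modality applied to `S`, together with a description `δ` of the world itself.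
  step : Formula X ML → List (Formula X ML) → Formula X ML
  step δ S = δ ∧ ⋀ (map ◇_ S) ∧ □ ⋁ S

  -- The Hintikka formulas of depth `k`. The list is fixed before any model is given, so it serves
  -- all models at once.
  types : ℕ → List (Formula X ML)
  types zero    = map diagram (splits xs)
  types (suc k) = cartesianProductWith step (types 0) (subsets (types k))

  md-types : ∀ k {χ} → χ ∈ᴸ types k → md χ ≤ k
  md-types zero χ∈ with (ps , qs) , _ , refl ← ∈-map⁻ diagram χ∈ =
    ⊔-lub (md-⋀ var ps λ _ → z≤n) (md-⋀ neg qs λ _ → z≤n)
  md-types (suc k) χ∈
    with δ , S , δ∈ , S∈ , refl ← ∈-cartesianProductWith⁻ step (types 0) (subsets (types k)) χ∈ =
    ⊔-lub (≤-trans (md-types 0 δ∈) z≤n)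
      (⊔-lub (md-⋀ ◇_ S (s≤s ∘ d)) (s≤s (md-⋁ S d)))
    where
    d : ∀ {χ} → χ ∈ᴸ S → md χ ≤ k
    d = md-types k ∘ ∈-subsets⇒⊆ S∈

  -- Applied both to teams and to the successor set `R M w`; the latter use, through `⊩-step`, lets
  -- worlds at depth `suc k` be treated as teams at depth `k`.
  Realises : (M : Model X ℓ) → Team M → List (Formula X ML) → Set ℓ
  Realises M T S =
    (∀ w → w ∈ T → Any (M , w ⊩_) S) × All (λ χ → ∃ λ w → w ∈ T × (M , w ⊩ χ)) S

  ⊩-step : (M : Model X ℓ) {w : W M} (δ : Formula X ML) (S : List (Formula X ML)) →
           (M , w ⊩ step δ S) ⇔ ((M , w ⊩ δ) × Realises M (R M w) S)
  ⊩-step M δ S = mk⇔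
    (λ { (hδ , h◇ , h□) → hδ , (λ v r → ⋁-elim M S (h□ v r)) , ⋀-elim M ◇_ S h◇ })
    (λ { (hδ , h□ , h◇) → hδ , ⋀-intro M ◇_ h◇ , λ v r → ⋁-intro M (h□ v r) })

  mutual

    has-type : ∀ k (M : Model X ℓ) (w : W M) → ∃ λ χ → χ ∈ᴸ types k × (M , w ⊩ χ)
    has-type zero M w =
      let s , s∈ , pos , negs = splits-complete (λ p → w ∈ π M p) xs
      in diagram s , ∈-map⁺ diagram s∈ , ⋀-intro M var pos , ⋀-intro M neg negs
    has-type (suc k) M w =
      let δ , δ∈ , hδ = has-type zero M w
          S , S∈ , real = realises-subset k M (R M w)
      in step δ S , ∈-cartesianProductWith⁺ step δ∈ S∈ , from (⊩-step M δ S) (hδ , real)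

    realises-subset : ∀ k (M : Model X ℓ) (T : Team M) →
                      ∃ λ S → S ∈ᴸ subsets (types k) × Realises M T S
    realises-subset k M T
      with (S , S′) , s∈ , pos , negs ←
           splits-complete (λ χ → ∃ λ w → w ∈ T × (M , w ⊩ χ)) (types k) =
      S , ∈-map⁺ proj₁ s∈ , cover , pos
      where
      cover : ∀ w → w ∈ T → Any (M , w ⊩_) S
      -- The type of `w` lies in one of the two halves, and not in the unrealised one, since `w`
      -- realises it.
      cover w w∈ with χ , χ∈ , h ← has-type k M w
        with ∈-++⁻ S (∈-resp-↭ (↭-sym (splits-↭ (types k) s∈)) χ∈)
      ... | inj₁ χ∈S  = lose χ∈S h
      ... | inj₂ χ∈S′ = ⊥-elim (All.lookup negs χ∈S′ (w , w∈ , h))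

  mutual

    -- A diagram settles every variable. At depth `suc k`, both successor sets realise the same `S`,
    -- so they are `k`-bisimilar as teams, which is the back-and-forth condition.
    same-type⇒bisim : ∀ k {χ} → χ ∈ᴸ types k → {M₁ M₂ : Model X ℓ} {w₁ : W M₁} {w₂ : W M₂} →
                      M₁ , w₁ ⊩ χ → M₂ , w₂ ⊩ χ → PointBisim k M₁ w₁ M₂ w₂
    same-type⇒bisim zero χ∈ {M₁} {M₂} h₁ h₂ p
      with (ps , qs) , s∈ , refl ← ∈-map⁻ diagram χ∈
      with ∈-++⁻ ps (∈-resp-↭ (↭-sym (splits-↭ xs s∈)) (∈-xs p))
    ... | inj₁ p∈ = mk⇔ (λ _ → All.lookup (⋀-elim M₂ var ps (proj₁ h₂)) p∈)
                        (λ _ → All.lookup (⋀-elim M₁ var ps (proj₁ h₁)) p∈)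
    ... | inj₂ p∈ = mk⇔ (λ v → ⊥-elim (All.lookup (⋀-elim M₁ neg qs (proj₂ h₁)) p∈ v))
                        (λ v → ⊥-elim (All.lookup (⋀-elim M₂ neg qs (proj₂ h₂)) p∈ v))
    same-type⇒bisim (suc k) χ∈ {M₁} {M₂} h₁ h₂
      with δ , S , δ∈ , S∈ , refl ← ∈-cartesianProductWith⁻ step (types 0) (subsets (types k)) χ∈ =
      let hδ₁ , real₁ = to (⊩-step M₁ δ S) h₁
          hδ₂ , real₂ = to (⊩-step M₂ δ S) h₂
      in same-type⇒bisim zero δ∈ hδ₁ hδ₂ , same-types⇒bisim k S∈ real₁ real₂

    same-types⇒bisim : ∀ k {S} → S ∈ᴸ subsets (types k) →
                       {M₁ M₂ : Model X ℓ} {T₁ : Team M₁} {T₂ : Team M₂} →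
                       Realises M₁ T₁ S → Realises M₂ T₂ S → TeamBisim k M₁ T₁ M₂ T₂
    same-types⇒bisim k S∈ (all₁ , some₁) (all₂ , some₂) =
      (λ w w∈ →
         let χ , χ∈ , h = find (all₁ w w∈) ; v , v∈ , h′ = All.lookup some₂ χ∈
         in v , v∈ , same-type⇒bisim k (∈-subsets⇒⊆ S∈ χ∈) h h′) ,
      (λ w w∈ →
         let χ , χ∈ , h = find (all₂ w w∈) ; v , v∈ , h′ = All.lookup some₁ χ∈
         in v , v∈ , same-type⇒bisim k (∈-subsets⇒⊆ S∈ χ∈) h′ h)

  -- Describing teams by inclusion atoms, with control of the modal depth.

  □^_⊤ : ℕ → Formula X ML
  □^ zero  ⊤ = ⊤′
  □^ suc k ⊤ = □ □^ k ⊤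

  ⊩-□^⊤ : ∀ k (M : Model X ℓ) {w : W M} → M , w ⊩ □^ k ⊤
  ⊩-□^⊤ zero    M     = ⊩-⊤′ M
  ⊩-□^⊤ (suc k) M v r = ⊩-□^⊤ k M

  md-□^⊤ : ∀ k → md (□^ k ⊤) ≡ k
  md-□^⊤ zero    = refl
  md-□^⊤ (suc k) = cong suc (md-□^⊤ k)

  infix 8 _⊑_

  _⊑_ : Formula X ML → Formula X ML → Formula X EMINCL[∨cl]
  φ ⊑ ψ = incl {n = 0} (λ _ → φ) (λ _ → ψ)

  ⊨-⊑ : (M : Model X ℓ) {T : Team M} (φ ψ : Formula X ML) →
        (M , T ⊨ φ ⊑ ψ) ⇔
        (∀ w → w ∈ T → ∃ λ v → v ∈ T × ((M , w ⊩ φ) ⇔ (M , v ⊩ ψ)))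
  ⊨-⊑ M φ ψ = mk⇔
    (λ h w w∈ → map₂ (map₂ λ e →
       ⇔-trans (⇔-sym (⊨-singleton⇔⊩ M φ)) (⇔-trans (e zero) (⊨-singleton⇔⊩ M ψ))) (h w w∈))
    (λ h w w∈ → map₂ (map₂ λ e _ →
       ⇔-trans (⊨-singleton⇔⊩ M φ) (⇔-trans e (⇔-sym (⊨-singleton⇔⊩ M ψ)))) (h w w∈))

  md-⊑ : ∀ φ ψ → md (φ ⊑ ψ) ≡ md φ ⊔ md ψ
  md-⊑ φ ψ = cong₂ _⊔_ (⊔-identityʳ (md φ)) (⊔-identityʳ (md ψ))

  module _ (k : ℕ) where

    everywhere somewhere : Formula X ML → Formula X EMINCL[∨cl]
    everywhere θ = θ ⊑ □^ k ⊤
    somewhere θ  = □^ k ⊤ ⊑ θ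

    ⊨-everywhere : (M : Model X ℓ) {T : Team M} (θ : Formula X ML) →
                   (M , T ⊨ everywhere θ) ⇔ (∀ w → w ∈ T → M , w ⊩ θ)
    ⊨-everywhere M θ = mk⇔
      (λ h w w∈ → let _ , _ , e = to (⊨-⊑ M θ (□^ k ⊤)) h w w∈ in from e (⊩-□^⊤ k M))
      (λ h → from (⊨-⊑ M θ (□^ k ⊤)) λ w w∈ →
         w , w∈ , mk⇔ (λ _ → ⊩-□^⊤ k M) (λ _ → h w w∈))

    ⊨-somewhere : (M : Model X ℓ) {T : Team M} (θ : Formula X ML) → Satisfiable T →
                  (M , T ⊨ somewhere θ) ⇔ (∃ λ w → w ∈ T × (M , w ⊩ θ))
    ⊨-somewhere M θ (u , u∈) = mk⇔
      -- The atom says nothing about an empty team; the world `u` is what triggers it.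
      (λ h → let v , v∈ , e = to (⊨-⊑ M (□^ k ⊤) θ) h u u∈ in v , v∈ , to e (⊩-□^⊤ k M))
      (λ { (v , v∈ , h) → from (⊨-⊑ M (□^ k ⊤) θ) λ w w∈ →
         v , v∈ , mk⇔ (λ _ → h) (λ _ → ⊩-□^⊤ k M) })

    md-everywhere : ∀ θ → md θ ≤ k → md (everywhere θ) ≤ k
    md-everywhere θ d = ≤-trans (≤-reflexive (md-⊑ θ (□^ k ⊤)))
      (⊔-lub d (≤-reflexive (md-□^⊤ k)))

    -- An equality, because `somewhere ⊥′` later fixes the depth of the whole disjunction.
    md-somewhere : ∀ θ → md θ ≤ k → md (somewhere θ) ≡ k
    md-somewhere θ d = trans (md-⊑ (□^ k ⊤) θ)
      (trans (cong (_⊔ md θ) (md-□^⊤ k)) (m≥n⇒m⊔n≡m d))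

    exactly : List (Formula X ML) → Formula X EMINCL[∨cl]
    exactly S = foldr _∧_ (everywhere (⋁ S)) (map somewhere S)

    ⊨-exactly : (M : Model X ℓ) {T : Team M} (S : List (Formula X ML)) → Satisfiable T →
                (M , T ⊨ exactly S) ⇔ Realises M T S
    ⊨-exactly M {T} S T≠∅ = mk⇔
      (λ h → let all , some = elim S h
             in (λ w w∈ → ⋁-elim M S (to (⊨-everywhere M (⋁ S)) all w w∈)) , some)
      (λ { (all , some) →
             intro some (from (⊨-everywhere M (⋁ S)) λ w w∈ → ⋁-intro M (all w w∈)) })
      where
      Somewhere : Formula X ML → Set _
      Somewhere χ = ∃ λ w → w ∈ T × (M , w ⊩ χ)
      -- The base of the fold is abstracted to `ψ`, since the recursion shortens the list while
      -- `⋁ S` must stay fixed.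
      elim : ∀ {ψ} S → M , T ⊨ foldr _∧_ ψ (map somewhere S) → (M , T ⊨ ψ) × All Somewhere S
      elim []      h       = h , []
      elim (χ ∷ S) (h , t) = map₂ (to (⊨-somewhere M χ T≠∅) h ∷_) (elim S t)
      intro : ∀ {ψ S} → All Somewhere S → M , T ⊨ ψ → M , T ⊨ foldr _∧_ ψ (map somewhere S)
      intro         []       t = t
      intro {S = χ ∷ _} (h ∷ hs) t = from (⊨-somewhere M χ T≠∅) h , intro hs t

    md-exactly : ∀ S → (∀ {χ} → χ ∈ᴸ S → md χ ≤ k) → md (exactly S) ≤ k
    md-exactly S d = go S d
      where
      go : ∀ S′ → (∀ {χ} → χ ∈ᴸ S′ → md χ ≤ k) →
           md (foldr _∧_ (everywhere (⋁ S)) (map somewhere S′)) ≤ k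
      go []       _  = md-everywhere (⋁ S) (md-⋁ S d)
      go (χ ∷ S′) d′ = ⊔-lub (≤-reflexive (md-somewhere χ (d′ (here refl)))) (go S′ (d′ ∘ there))

    -- The base case holds of the empty team only, so it acts as ⊥ while having depth k.
    oneOf : List (List (Formula X ML)) → Formula X EMINCL[∨cl]
    oneOf Ss = foldr _∨cl_ (somewhere ⊥′) (map exactly Ss)

    ⊨-oneOf : (M : Model X ℓ) {T : Team M} (Ss : List (List (Formula X ML))) → Satisfiable T →
              (M , T ⊨ oneOf Ss) ⇔ Any (Realises M T) Ss
    ⊨-oneOf M Ss T≠∅ = mk⇔ (elim Ss) intro
      where
      elim : ∀ Ss → M , _ ⊨ oneOf Ss → Any (Realises M _) Ss
      elim [] h with _ , _ , v , ¬v ← to (⊨-somewhere M ⊥′ T≠∅) h = ⊥-elim (¬v v)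
      elim (S ∷ Ss) (inj₁ h) = here (to (⊨-exactly M S T≠∅) h)
      elim (S ∷ Ss) (inj₂ h) = there (elim Ss h)
      intro : ∀ {Ss} → Any (Realises M _) Ss → M , _ ⊨ oneOf Ss
      intro {S ∷ _} (here h)  = inj₁ (from (⊨-exactly M S T≠∅) h)
      intro         (there h) = inj₂ (intro h)

    -- Each `exactly S` has depth at most `k`, so the base of the fold decides the maximum, even
    -- when `Ss` is empty.
    md-oneOf : ∀ Ss → (∀ {S} → S ∈ᴸ Ss → S ∈ᴸ subsets (types k)) → md (oneOf Ss) ≡ k
    md-oneOf []       _  = md-somewhere ⊥′ z≤n
    md-oneOf (S ∷ Ss) s =
      trans (cong (md (exactly S) ⊔_) (md-oneOf Ss (s ∘ there)))
        (m≤n⇒m⊔n≡n (md-exactly S (md-types k ∘ ∈-subsets⇒⊆ (s (here refl)))))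

    invariant⇒characterized : ∀ {p} (P : TeamProperty X ℓ p) → BisimInvariant k P →
      ∃ λ (φ : Formula X EMINCL[∨cl]) → md φ ≡ k × φ Characterizes P
    invariant⇒characterized P inv =
      oneOf Ss , md-oneOf Ss (proj₁ ∘ ∈-filter⁻ realised?) , λ M T → mk⇔
        (λ h → let T≠∅ = holds⇒nonempty P M T h
                   S , S∈ , real = realises-subset k M T
               in T≠∅ ,
                  from (⊨-oneOf M Ss T≠∅) (lose (∈-filter⁺ realised? S∈ (M , T , h , real)) real))
        (λ { (T≠∅ , t) →
           let S , S∈ , real = find (to (⊨-oneOf M Ss T≠∅) t)
               -- Filtering recorded a team `T′` with the property that realises the same `S`. It is
               -- `k`-bisimilar to `T`, and invariance carries the property over.
               S∈′ , M′ , T′ , h , real′ = ∈-filter⁻ realised? S∈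
           in inv M′ T′ M T h (same-types⇒bisim k S∈′ real′ real) })
      where
      -- This ranges over all models and an arbitrary `P`, so excluded middle is applied at a higher
      -- universe level.
      realised? : (S : List (Formula X ML)) →
                  Dec (∃ λ M → ∃ λ T → holds P M T × Realises M T S)
      realised? _ = decide _
      Ss : List (List (Formula X ML))
      Ss = filter realised? (subsets (types k))

theorem4p4 : (∀ {a} → ExcludedMiddle a) →
    ∀ {ℓ p} (X : Set) (n : ℕ) → X ↔ Fin (suc n) →
    (P : TeamProperty X ℓ p) (k : ℕ) →
    BisimInvariant k P ⇔
    (∃ λ (φ : Formula X EMINCL[∨cl]) → md φ ≡ k × φ Characterizes P)
theorem4p4 lem X n X↔Fin P k = mk⇔
  (Hintikka.invariant⇒characterized lem X (Inverse.from X↔Fin zero)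
    (map (Inverse.from X↔Fin) (allFin (suc n)))
    (λ p → subst (_∈ᴸ map (Inverse.from X↔Fin) (allFin (suc n)))
             (Inverse.strictlyInverseʳ X↔Fin p)
             (∈-map⁺ (Inverse.from X↔Fin) (∈-allFin (Inverse.to X↔Fin p))))
    k P)
  (λ { (φ , refl , char) → characterizes⇒invariant {P = P} φ ≤-refl char })
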